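{- Let $G_\tau=(V,E;\tau)$ be a bidirected graph. For each linear ordering $<$ of $E$, $G_\tau-S_<(G_\tau)$ is a transitive reduction of $G_\tau$. Conversely, if $R$ is a transitive reduction of $G_\tau$, then $R=G_\tau-S_<(G_\tau)$ for some linear ordering $<$ of $E$.
   Context: A graph $G=(V,E)$ is finite, with loops and multiple edges allowed. A half-edge is a pair $(e,x)$ with $e$ incident with $x$ (a loop has two half-edges at its vertex). A bidirected graph $G_\tau=(V,E;\tau)$ is a graph with a map $\tau$ assigning $+1$ or $-1$ to every half-edge; an edge with ends $x,y$ and $\tau(e,x)=\alpha,\tau(e,y)=\beta$ is written $\{x^\alpha,y^\beta\}$. A partial graph of $G_\tau$ is $(V,F;\tau|_F)$ with $F\subseteq E$. A chain is $x_0,e_1,x_1,\ldots,e_k,x_k$ where $e_i$ has ends $x_{i-1},x_i$; when $e_i$ is traversed from $x_{i-1}$ to $x_i$, $\tau(e_i,x_{i-1}),\tau(e_i,x_i)$ denote the values at the corresponding half-edges. For $\alpha,\beta\in\{\pm1\}$ a b-walk from $x^\alpha$ to $y^\beta$ is a chain $x=x_0,e_1,\ldots,e_k,x_k=y$ with $k\ge1$, $\tau(e_1,x_0)=\alpha$, $\tau(e_k,x_k)=\beta$ and $\tau(e_i,x_i)+\tau(e_{i+1},x_i)=0$ for $1\le i\le k-1$. A b-path from $x^\alpha$ to $y^\beta$ is a b-walk from $x^\alpha$ to $y^\beta$ minimal with these properties (no b-walk from $x^\alpha$ to $y^\beta$ has as edge sequence a proper subsequence, in the same order, of its edge sequence);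 $x=y$ allowed. For a partial graph $H_\tau$ of $G_\tau$, $\mathrm{ft}(G_\tau;H_\tau)$ is the partial graph of $G_\tau$ whose edges are the edges of $G_\tau$ that are edges of $H_\tau$ or are of the form $\{x^\alpha,y^\beta\}$ with a b-path from $x^\alpha$ to $y^\beta$ in $H_\tau$. A transitive reduction of $G_\tau$ is a minimal partial graph $R$ of $G_\tau$ with $\mathrm{ft}(G_\tau;R)=G_\tau$. Given a linear ordering $e_1<e_2<\cdots<e_n$ of $E$, define partial graphs $(G_\tau)_0=G_\tau$ and, for $i=1,\ldots,n$, $(G_\tau)_i=(G_\tau)_{i-1}-e_i$ if $e_i=\{x^\alpha,y^\beta\}$ is an edge of $(G_\tau)_{i-1}$ and $(G_\tau)_{i-1}-e_i$ contains a b-path from $x^\alpha$ to $y^\beta$, and $(G_\tau)_i=(G_\tau)_{i-1}$ otherwise. Put $S_<(G_\tau)=\{e_i\in E: e_i\in(G_\tau)_{i-1},\ e_i\notin(G_\tau)_i\}$. -}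

module Defs where

open import Data.Nat using (ℕ)
open import Data.Fin using (Fin)
open import Data.Fin.Subset using (Subset; _∈_; _⊆_; _-_; _∪_; ⁅_⁆; ⊤; ⊥; _─_)
open import Data.Fin.Permutation using (Permutation′; _⟨$⟩ʳ_)
open import Data.Bool using (Bool; true; false)
open import Data.Sign using (Sign; opposite)
open import Data.Product using (Σ; _×_; _,_; proj₁; ∃)
open import Data.Sum using (_⊎_)
open import Data.List using (List; []; _∷_; [_]; map; allFin)
open import Data.List.Relation.Unary.All using (All)
import Data.List.Relation.Binary.Sublist.Propositional as SubL
open import Relation.Binary.PropositionalEquality using (_≡_; _≢_)
open import Relation.Nullary using (¬_)

-- A finite bidirected graph: vertices Fin n, edges Fin m.
-- Edge e has ends end₁ e, end₂ e (equal for a loop); sign₁ e = τ(e, end₁ e)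
-- and sign₂ e = τ(e, end₂ e) are the values at its two half-edges.
-- So e = {end₁ e ^ sign₁ e , end₂ e ^ sign₂ e}.
record BiGraph : Set where
  field
    n m   : ℕ
    end₁  : Fin m → Fin n
    end₂  : Fin m → Fin n
    sign₁ : Fin m → Sign
    sign₂ : Fin m → Sign

module _ (G : BiGraph) where
  open BiGraph G

  -- A step of a chain: an edge together with the direction of traversal
  -- (true: from the first half-edge to the second; false: reversed).
  Step : Set
  Step = Fin m × Bool

  tailV headV : Step → Fin n
  tailV (e , true)  = end₁ e
  tailV (e , false) = end₂ e
  headV (e , true)  = end₂ e
  headV (e , false) = end₁ e

  -- τ(e_i, x_{i-1}) and τ(e_i, x_i) for the step
  tailS headS : Step → Sign
  tailS (e , true)  = sign₁ e
  tailS (e , false) = sign₂ e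
  headS (e , true)  = sign₂ e
  headS (e , false) = sign₁ e

  -- BWalk x α w y β : w is a b-walk from x^α to y^β (k ≥ 1 steps).
  -- Condition τ(e_i,x_i) + τ(e_{i+1},x_i) = 0 is: headS s ≡ opposite (tail sign of next).
  data BWalk : Fin n → Sign → List Step → Fin n → Sign → Set where
    one  : ∀ {x α y β} (s : Step) →
           tailV s ≡ x → tailS s ≡ α → headV s ≡ y → headS s ≡ β →
           BWalk x α [ s ] y β
    cons : ∀ {x α y β γ w} (s : Step) →
           tailV s ≡ x → tailS s ≡ α → headS s ≡ opposite γ →
           BWalk (headV s) γ w y β →
           BWalk x α (s ∷ w) y β

  edgeSeq : List Step → List (Fin m)
  edgeSeq = map proj₁

  -- proper subsequence (in the same order)
  _⊏_ : List (Fin m) → List (Fin m) → Set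
  xs ⊏ ys = SubL._⊆_ xs ys × xs ≢ ys

  -- b-path: a b-walk minimal w.r.t. proper subsequences of its edge sequence
  BPath : Fin n → Sign → List Step → Fin n → Sign → Set
  BPath x α w y β =
    BWalk x α w y β ×
    (∀ w' → BWalk x α w' y β → ¬ (edgeSeq w' ⊏ edgeSeq w))

  -- Partial graphs are subsets of the edge set.
  -- The partial graph H contains a b-path from end₁ e ^ sign₁ e to end₂ e ^ sign₂ e.
  HasBPath : Subset m → Fin m → Set
  HasBPath H e = Σ (List Step) λ w →
    BPath (end₁ e) (sign₁ e) w (end₂ e) (sign₂ e) × All (λ s → proj₁ s ∈ H) w

  -- edge e belongs to ft(G_τ; H)
  InFt : Subset m → Fin m → Set
  InFt H e = e ∈ H ⊎ HasBPath H e

  -- ft(G_τ; H) = G_τ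
  FtFull : Subset m → Set
  FtFull H = ∀ e → InFt H e

  -- R is a transitive reduction of G_τ: minimal partial graph with ft(G_τ;R) = G_τ
  IsTransitiveReduction : Subset m → Set
  IsTransitiveReduction R =
    FtFull R × (∀ R' → R' ⊆ R → FtFull R' → R' ≡ R)

  -- SeqDel H es S : starting from partial graph H and processing the edges es in
  -- order by the rule defining (G_τ)_i, S is the set of deleted edges.
  data SeqDel : Subset m → List (Fin m) → Subset m → Set where
    done : ∀ {H} → SeqDel H [] ⊥
    del  : ∀ {H e es S} → e ∈ H → HasBPath (H - e) e →
           SeqDel (H - e) es S → SeqDel H (e ∷ es) (⁅ e ⁆ ∪ S)
    keep : ∀ {H e es S} → ¬ (e ∈ H × HasBPath (H - e) e) →
           SeqDel H es S → SeqDel H (e ∷ es) S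

  -- A linear ordering e_1 < ... < e_m of E, given by a permutation π (e_{i+1} = π i).
  orderList : Permutation′ m → List (Fin m)
  orderList π = map (π ⟨$⟩ʳ_) (allFin m)

  -- S is S_<(G_τ) for the ordering π
  IsS : Permutation′ m → Subset m → Set
  IsS π S = SeqDel ⊤ (orderList π) S

  -- G_τ - S
  delete : Subset m → Subset m
  delete S = ⊤ ─ S

module Submission where

-- Transitive reductions of a bidirected graph G are exactly the graphs
-- G - S_<(G) obtained by deleting edges greedily along a linear ordering.
--
-- The proof rests on a characterisation of transitive reductions: R is one iff
-- ft(G;R) = G and R is irredundant, i.e. no edge e of R has a b-path in R - e
-- (`reduction⇒irredundant`, `irredundant⇒reduction`).  Two walk facts drive everything: a b-walk all of whose
-- edges are implied by T can be rebuilt inside T (`substitute`), and every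
-- b-walk in T shrinks to a b-path in T (a shortest walk, `walk⇒path`);
-- existence of a b-walk is moreover decidable because repetition-free walks
-- have at most 2|V| steps (`walk?`), so the greedy deletion can be run.
--
-- Forward: along any ordering, the surviving edges still imply every edge
-- (`survivors-imply`), and a surviving edge was not implied by the others when
-- it was examined, so is not implied by the final graph either
-- (`survivors-irredundant`).  Converse: order E - R before R; then every edge
-- outside R is deleted (R implies it) and none of R is (R is irredundant).

open import Defs
open import Data.Nat using (ℕ; zero; suc; _*_; _≤_; _<_; s≤s)
import Data.Nat.Properties as ℕP
open import Data.Nat.Induction using (<-wellFounded)
open import Induction.WellFounded using (Acc; acc)
open import Data.Fin as F using (Fin; toℕ; fromℕ<; combine)
import Data.Fin.Properties as FP
open import Data.Fin.Subset using (Subset; _∈_; _∉_; _⊆_; _-_; _∪_; ⁅_⁆; ⊤; ⊥; _─_)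
import Data.Fin.Subset.Properties as SP
open import Data.Fin.Permutation using (Permutation′; _⟨$⟩ʳ_; _⟨$⟩ˡ_; inverseʳ; lift₀; transpose; _∘ₚ_; id)
open import Data.Bool using (true; false; not)
open import Data.Sign using (Sign; opposite)
import Data.Sign.Properties as SgP
open import Data.Product using (Σ; _×_; _,_; proj₁; ∃)
import Data.Product.Properties as ×P
open import Data.Sum using (_⊎_; inj₁; inj₂)
open import Data.List using (List; []; _∷_; [_]; _++_; map; length; lookup; allFin; tabulate; drop)
import Data.List.Properties as LP
open import Data.List.Relation.Unary.All as All using (All; []; _∷_)
import Data.List.Relation.Unary.All.Properties as AllP
open import Data.List.Relation.Unary.Any using (here; there)
open import Data.List.Relation.Unary.Any.Properties using (¬Any[])
open import Data.List.Relation.Unary.AllPairs using ([]; _∷_)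
open import Data.List.Relation.Unary.Unique.Propositional using (Unique)
import Data.List.Relation.Unary.Unique.Propositional.Properties as UniqueP
open import Data.List.Membership.Propositional using () renaming (_∈_ to _∈ₗ_)
import Data.List.Membership.Propositional.Properties as MP
import Data.List.Relation.Binary.Sublist.Propositional as SubL
import Data.List.Relation.Binary.Sublist.Propositional.Properties as SubLP
open import Data.List.Relation.Binary.Pointwise using (Pointwise-≡⇒≡)
open import Data.Vec using (_∷_)
open import Data.Empty using (⊥-elim)
open import Relation.Binary.PropositionalEquality hiding ([_])
open import Relation.Nullary using (¬_; Dec; yes; no; ¬?)
open import Relation.Nullary.Decidable using (map′; _×-dec_; _⊎-dec_; decidable-stable)

-- Signs: equations between a sign and an opposite sign can be turned around.
opposite-swap : ∀ {α β} → α ≡ opposite β → β ≡ opposite α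
opposite-swap {β = β} refl = sym (SgP.opposite-involutive β)

-- A proper sublist is strictly shorter (it bounds the length of b-paths).
proper-sublist-shorter : ∀ {A : Set} {xs ys : List A} →
                         SubL._⊆_ xs ys → xs ≢ ys → length xs < length ys
proper-sublist-shorter sub xs≢ys =
  ℕP.≤∧≢⇒< (SubLP.length-mono-≤ sub)
            (λ same → xs≢ys (Pointwise-≡⇒≡ (SubLP.to-≋ same sub)))

-- Distinct positions of a repetition-free list hold distinct entries.
unique-lookup : ∀ {A : Set} {xs : List A} → Unique xs →
                ∀ {i j} → i F.< j → lookup xs i ≢ lookup xs j
unique-lookup (x∉xs ∷ _) {F.zero} {F.suc j} _ = All.lookup x∉xs (MP.∈-lookup j)
unique-lookup (_ ∷ u) {F.suc i} {F.suc j} (s≤s i<j) = unique-lookup u i<j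

-- Pigeonhole: a repetition-free list in a type coded injectively into Fin k
-- has at most k entries.
unique-length : ∀ {A : Set} {k} (code : A → Fin k) → (∀ {a b} → code a ≡ code b → a ≡ b) →
                ∀ {xs} → Unique xs → length xs ≤ k
unique-length {k = k} code injective {xs} u with length xs ℕP.≤? k
... | yes fits = fits
... | no ¬fits =
  let (i , j , i<j , same) = FP.pigeonhole (ℕP.≰⇒> ¬fits) (λ i → code (lookup xs i))
  in ⊥-elim (unique-lookup u i<j (injective same))

-- Elements of q do not survive in p ─ q; in particular x ∉ p - x.
∈─⇒∉ : ∀ {k} {x : Fin k} (p q : Subset k) → x ∈ p ─ q → x ∉ q
∈─⇒∉ {x = F.zero} (_ ∷ p) (true ∷ q) ()
∈─⇒∉ {x = F.zero} (_ ∷ p) (false ∷ q) _ ()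
∈─⇒∉ {x = F.suc x} (_ ∷ p) (_ ∷ q) x∈ x∈q = ∈─⇒∉ p q (SP.drop-there x∈) (SP.drop-there x∈q)

x∉p-x : ∀ {k} {x : Fin k} (p : Subset k) → x ∉ p - x
x∉p-x {x = x} p x∈ = ∈─⇒∉ p ⁅ x ⁆ x∈ (SP.x∈⁅x⁆ x)

-- Removing the same set from a smaller set leaves a smaller set.
─-monoˡ : ∀ {k} {p q : Subset k} (r : Subset k) → p ⊆ q → p ─ r ⊆ q ─ r
─-monoˡ {p = p} r p⊆q x∈ = SP.x∈p∧x∉q⇒x∈p─q (p⊆q (SP.p─q⊆p p r x∈)) (∈─⇒∉ p r x∈)

-- A set missing x lies inside q - x as soon as it lies inside q.
⊆-minus : ∀ {k} {p q : Subset k} {x} → p ⊆ q → x ∉ p → p ⊆ q - x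
⊆-minus p⊆q x∉p y∈p = SP.x∈p∧x≢y⇒x∈p-y (p⊆q y∈p) (λ { refl → x∉p y∈p })

-- Deleting e and then S is deleting ⁅ e ⁆ ∪ S (one step of the deletion process).
delete-step : ∀ {k} (H : Subset k) e S → H ─ (⁅ e ⁆ ∪ S) ≡ (H - e) ─ S
delete-step H e S = sym (SP.p─q─r≡p─q∪r H ⁅ e ⁆ S)

-- The list of values of a permutation: the linear ordering it describes
-- (for edge sets this is `orderList`).  Every element occurs in it.
permutationList : ∀ {k} → Permutation′ k → List (Fin k)
permutationList π = map (π ⟨$⟩ʳ_) (allFin _)

∈-permutationList : ∀ {k} (π : Permutation′ k) i → i ∈ₗ permutationList π
∈-permutationList π i = subst (_∈ₗ permutationList π) (inverseʳ π)
                              (MP.∈-map⁺ (π ⟨$⟩ʳ_) (MP.∈-allFin (π ⟨$⟩ˡ i)))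

-- A linear ordering of Fin k listing first all elements with P, then all without.
Partitioning : ∀ k → (Fin k → Set) → Set
Partitioning k P = Σ (Permutation′ k) λ π → Σ (List (Fin k)) λ A → Σ (List (Fin k)) λ B →
  permutationList π ≡ A ++ B × All P A × All (λ i → ¬ P i) B

-- Such an ordering exists for every decidable P: move an element with P to
-- the front by a transposition and partition the remaining k positions.
partition-order : ∀ k (P : Fin k → Set) → (∀ i → Dec (P i)) → Partitioning k P
partition-order zero P P? = id , [] , [] , refl , [] , []
partition-order (suc k) P P? with FP.any? P?
... | no none = id , [] , permutationList id , refl , [] , All.universal (λ i p → none (i , p)) _
... | yes (e , pe) = extend (partition-order k (λ i → P (place i)) (λ i → P? (place i)))
  where
  τ = transpose F.zero e
  place : Fin k → Fin (suc k)
  place i = τ ⟨$⟩ʳ F.suc i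
  extend : Partitioning k (λ i → P (place i)) → Partitioning (suc k) P
  extend (π , A , B , π≡A++B , inA , notB) =
    lift₀ π ∘ₚ τ , e ∷ map place A , map place B , cong (e ∷_) order≡ , pe ∷ AllP.map⁺ inA , AllP.map⁺ notB
    where
    open ≡-Reasoning
    order≡ : map ((lift₀ π ∘ₚ τ) ⟨$⟩ʳ_) (tabulate F.suc) ≡ map place A ++ map place B
    order≡ = begin
      map ((lift₀ π ∘ₚ τ) ⟨$⟩ʳ_) (tabulate F.suc)   ≡⟨ LP.map-tabulate F.suc _ ⟩
      tabulate (λ i → place (π ⟨$⟩ʳ i))             ≡⟨ LP.map-tabulate (λ i → i) _ ⟨
      map (λ i → place (π ⟨$⟩ʳ i)) (allFin k)       ≡⟨ LP.map-∘ (allFin k) ⟩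
      map place (permutationList π)                 ≡⟨ cong (map place) π≡A++B ⟩
      map place (A ++ B)                            ≡⟨ LP.map-++ place A B ⟩
      map place A ++ map place B                    ∎

-- The two signs, coded in Fin 2 (used to count the half-edge states).
signIndex : Sign → Fin 2
signIndex Sign.- = F.zero
signIndex Sign.+ = F.suc F.zero

signIndex-injective : ∀ {α β} → signIndex α ≡ signIndex β → α ≡ β
signIndex-injective {Sign.-} {Sign.-} _ = refl
signIndex-injective {Sign.+} {Sign.+} _ = refl

module _ (G : BiGraph) where
  open BiGraph G

  -- A step of a walk uses an edge of the partial graph T.
  StepIn : Subset m → Step G → Set
  StepIn T s = proj₁ s ∈ T

  -- A b-walk from x^α to y^β in the partial graph T.
  WalkIn : Subset m → Fin n → Sign → Fin n → Sign → Set
  WalkIn T x α y β = Σ (List (Step G)) λ w → BWalk G x α w y β × All (StepIn T) w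

  -- T implies e: T contains a b-walk joining the two half-edges of e.
  Implied : Subset m → Fin m → Set
  Implied T e = WalkIn T (end₁ e) (sign₁ e) (end₂ e) (sign₂ e)

  -- An edge of T is implied by T.
  single : ∀ {T} e → e ∈ T → Implied T e
  single e e∈T = [ (e , true) ] , one (e , true) refl refl refl refl , e∈T ∷ []

  -- Two b-walks glue to a b-walk when the signs at the junction are opposite.
  append : ∀ {x α z γ δ y β w₁ w₂} → BWalk G x α w₁ z γ → BWalk G z δ w₂ y β →
           γ ≡ opposite δ → BWalk G x α (w₁ ++ w₂) y β
  append (one s tx tα refl refl) q junction = cons s tx tα junction q
  append (cons s tx tα h p) q junction = cons s tx tα h (append p q junction)

  -- Reversal of walks: traverse the steps backwards in reverse order.
  flipStep : Step G → Step G
  flipStep (e , d) = e , not d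

  backStep : ∀ s → BWalk G (headV G s) (headS G s) [ flipStep s ] (tailV G s) (tailS G s)
  backStep (e , true) = one _ refl refl refl refl
  backStep (e , false) = one _ refl refl refl refl

  reverseWalk : List (Step G) → List (Step G)
  reverseWalk [] = []
  reverseWalk (s ∷ w) = reverseWalk w ++ [ flipStep s ]

  reverse-bwalk : ∀ {x α w y β} → BWalk G x α w y β → BWalk G y β (reverseWalk w) x α
  reverse-bwalk (one s refl refl refl refl) = backStep s
  reverse-bwalk (cons s refl refl h p) = append (reverse-bwalk p) (backStep s) (opposite-swap h)

  reverse-in : ∀ {T w} → All (StepIn T) w → All (StepIn T) (reverseWalk w)
  reverse-in [] = []
  reverse-in (s∈T ∷ w∈T) = AllP.++⁺ (reverse-in w∈T) (s∈T ∷ [])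

  -- A step along an edge implied by T can be replaced by a b-walk in T.
  replaceStep : ∀ {T} s → Implied T (proj₁ s) →
                WalkIn T (tailV G s) (tailS G s) (headV G s) (headS G s)
  replaceStep (e , true) r = r
  replaceStep (e , false) (w , p , w∈T) = reverseWalk w , reverse-bwalk p , reverse-in w∈T

  -- Substitution: a b-walk all of whose edges are implied by T yields one in T.
  substitute : ∀ {T x α w y β} → BWalk G x α w y β →
               All (λ s → Implied T (proj₁ s)) w → WalkIn T x α y β
  substitute (one s refl refl refl refl) (r ∷ []) = replaceStep s r
  substitute (cons s refl refl h p) (r ∷ rs) =
    let (w₁ , p₁ , in₁) = replaceStep s r
        (w₂ , p₂ , in₂) = substitute p rs
    in w₁ ++ w₂ , append p₁ p₂ h , AllP.++⁺ in₁ in₂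

  -- b-walks in T with exactly k steps; their existence is decidable.
  WalkOfLength : Subset m → ℕ → Fin n → Sign → Fin n → Sign → Set
  WalkOfLength T k x α y β =
    Σ (List (Step G)) λ w → length w ≡ k × BWalk G x α w y β × All (StepIn T) w

  -- Finitely many steps: a decidable property of steps has a decidable existence.
  step? : ∀ {P : Step G → Set} → (∀ s → Dec (P s)) → Dec (Σ (Step G) P)
  step? {P} P? = map′ to from (FP.any? (λ e → P? (e , true) ⊎-dec P? (e , false)))
    where
    to : ∃ (λ e → P (e , true) ⊎ P (e , false)) → Σ (Step G) P
    to (e , inj₁ p) = (e , true) , p
    to (e , inj₂ p) = (e , false) , p
    from : Σ (Step G) P → ∃ (λ e → P (e , true) ⊎ P (e , false))
    from ((e , true) , p) = e , inj₁ p
    from ((e , false) , p) = e , inj₂ p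

  -- A walk of length k+1 is a first step followed by a walk of length k
  -- (or by nothing if k = 0); decide by searching the first step.
  walkOfLength? : ∀ T k x α y β → Dec (WalkOfLength T k x α y β)
  walkOfLength? T zero x α y β = no λ { ([] , _ , () , _) }
  walkOfLength? T (suc zero) x α y β =
    map′ to from (step? {P = Single} λ s → (tailV G s FP.≟ x) ×-dec ((tailS G s SgP.≟ α) ×-dec
      ((headV G s FP.≟ y) ×-dec ((headS G s SgP.≟ β) ×-dec (proj₁ s SP.∈? T)))))
    where
    -- s alone is a b-walk from x^α to y^β in T
    Single : Step G → Set
    Single s = tailV G s ≡ x × tailS G s ≡ α × headV G s ≡ y × headS G s ≡ β × StepIn T s
    to : Σ (Step G) Single → WalkOfLength T 1 x α y β
    to (s , tx , tα , hy , hβ , s∈T) = [ s ] , refl , one s tx tα hy hβ , s∈T ∷ []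
    from : WalkOfLength T 1 x α y β → Σ (Step G) Single
    from ((s ∷ []) , _ , one .s tx tα hy hβ , s∈T ∷ []) = s , tx , tα , hy , hβ , s∈T
    from ((s ∷ []) , _ , cons .s _ _ _ () , _)
  walkOfLength? T (suc (suc k)) x α y β =
    map′ to from (step? {P = First} λ s → (tailV G s FP.≟ x) ×-dec ((tailS G s SgP.≟ α) ×-dec
      ((proj₁ s SP.∈? T) ×-dec walkOfLength? T (suc k) (headV G s) (opposite (headS G s)) y β)))
    where
    -- s starts at x^α in T and is followed by a (k+1)-step b-walk in T
    First : Step G → Set
    First s = tailV G s ≡ x × tailS G s ≡ α × StepIn T s ×
              WalkOfLength T (suc k) (headV G s) (opposite (headS G s)) y β
    to : Σ (Step G) First → WalkOfLength T (suc (suc k)) x α y β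
    to (s , tx , tα , s∈T , (w , len , p , w∈T)) =
      s ∷ w , cong suc len , cons s tx tα (opposite-swap refl) p , s∈T ∷ w∈T
    from : WalkOfLength T (suc (suc k)) x α y β → Σ (Step G) First
    from ((s ∷ []) , () , one .s _ _ _ _ , _)
    from ((s ∷ w) , len , cons .s tx tα h p , s∈T ∷ w∈T) =
      s , tx , tα , s∈T , (w , ℕP.suc-injective len , subst (λ γ → BWalk G _ γ w y β) (opposite-swap h) p , w∈T)

  -- b-walks in T with fewer than N steps, and the decision procedure for them.
  ShorterThan : ℕ → Subset m → Fin n → Sign → Fin n → Sign → Set
  ShorterThan N T x α y β = Σ (Fin N) λ k → WalkOfLength T (toℕ k) x α y β

  shorterThan? : ∀ N T x α y β → Dec (ShorterThan N T x α y β)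
  shorterThan? N T x α y β = FP.any? λ k → walkOfLength? T (toℕ k) x α y β

  shorter-intro : ∀ {N T x α y β w} → length w < N → BWalk G x α w y β → All (StepIn T) w →
                  ShorterThan N T x α y β
  shorter-intro {w = w} shorter p w∈T = fromℕ< shorter , w , sym (FP.toℕ-fromℕ< shorter) , p , w∈T

  -- A b-walk whose edge sequence is a proper subsequence of that of w is
  -- shorter than w and uses only edges of w.
  ⊏-shorter : ∀ {w' w} → _⊏_ G (edgeSeq G w') (edgeSeq G w) → length w' < length w
  ⊏-shorter {w'} {w} (sub , ≢) =
    subst₂ _<_ (LP.length-map proj₁ w') (LP.length-map proj₁ w) (proper-sublist-shorter sub ≢)

  ⊏-in : ∀ {T w' w} → _⊏_ G (edgeSeq G w') (edgeSeq G w) → All (StepIn T) w → All (StepIn T) w'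
  ⊏-in (sub , _) w∈T = AllP.map⁻ (SubLP.All-resp-⊆ sub (AllP.map⁺ w∈T))

  -- b-paths in T.
  PathIn : Subset m → Fin n → Sign → Fin n → Sign → Set
  PathIn T x α y β = Σ (List (Step G)) λ w → BPath G x α w y β × All (StepIn T) w

  -- A shortest b-walk in T is a b-path; hence every b-walk in T yields a b-path.
  walk⇒path : ∀ {T x α y β} → WalkIn T x α y β → PathIn T x α y β
  walk⇒path {T} {x} {α} {y} {β} (w , p , w∈T) = shorten w (<-wellFounded (length w)) p w∈T
    where
    shorten : ∀ w → Acc _<_ (length w) → BWalk G x α w y β → All (StepIn T) w → PathIn T x α y β
    shorten w (acc smaller) p w∈T with shorterThan? (length w) T x α y β
    ... | yes (k , w' , len , p' , w'∈T) =
      shorten w' (smaller (subst (_< length w) (sym len) (FP.toℕ<n k))) p' w'∈T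
    ... | no none =
      w , (p , λ w' p' sub → none (shorter-intro (⊏-shorter sub) p' (⊏-in sub w∈T))) , w∈T

  -- The state of a walk before a step: current vertex and sign of the half-edge left by.
  State : Set
  State = Fin n × Sign

  startState : Step G → State
  startState s = tailV G s , tailS G s

  -- States are coded injectively in Fin (2n), bounding repetition-free walks.
  stateIndex : State → Fin (n * 2)
  stateIndex (x , α) = combine x (signIndex α)

  stateIndex-injective : ∀ {a b} → stateIndex a ≡ stateIndex b → a ≡ b
  stateIndex-injective {x , α} {y , β} same =
    let (x≡y , α≡β) = FP.combine-injective x (signIndex α) y (signIndex β) same
    in cong₂ _,_ x≡y (signIndex-injective α≡β)

  _≟ₛ_ : (a b : State) → Dec (a ≡ b)
  _≟ₛ_ = ×P.≡-dec FP._≟_ SgP._≟_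

  open import Data.List.Membership.DecPropositional _≟ₛ_ using (_∈?_)

  -- The part of a b-walk from one of its states onwards is a b-walk from that state.
  suffix : ∀ {x α w y β z γ} → (z , γ) ∈ₗ map startState w → BWalk G x α w y β →
           Σ ℕ λ k → BWalk G z γ (drop k w) y β
  suffix (here refl) (one s refl refl hy hβ) = 0 , one s refl refl hy hβ
  suffix (here refl) (cons s refl refl h p) = 0 , cons s refl refl h p
  suffix (there i) (cons s _ _ _ p) = let (k , q) = suffix i p in suc k , q

  -- Every b-walk in T can be shortcut to one that never repeats a state.
  simplify : ∀ {T x α w y β} → BWalk G x α w y β → All (StepIn T) w →
             Σ (List (Step G)) λ w' → BWalk G x α w' y β × All (StepIn T) w' × Unique (map startState w')
  simplify (one s tx tα hy hβ) w∈T = [ s ] , one s tx tα hy hβ , w∈T , [] ∷ []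
  simplify (cons s refl refl h p) (s∈T ∷ w∈T) with simplify p w∈T
  ... | w' , p' , w'∈T , u with startState s ∈? map startState w'
  ...   | yes revisited =
          let (k , q) = suffix revisited p'
          in drop k w' , q , AllP.drop⁺ k w'∈T , subst Unique (LP.drop-map k w') (UniqueP.drop⁺ k u)
  ...   | no new = s ∷ w' , cons s refl refl h p' , s∈T ∷ w'∈T , AllP.¬Any⇒All¬ _ new ∷ u

  -- Existence of a b-walk in T is decidable: if there is one, there is one
  -- with at most 2n steps (a repetition-free one).
  walk? : ∀ T x α y β → Dec (WalkIn T x α y β)
  walk? T x α y β = map′ forget bounded (shorterThan? (suc (n * 2)) T x α y β)
    where
    forget : ShorterThan (suc (n * 2)) T x α y β → WalkIn T x α y β
    forget (_ , w , _ , p , w∈T) = w , p , w∈T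
    bounded : WalkIn T x α y β → ShorterThan (suc (n * 2)) T x α y β
    bounded (w , p , w∈T) =
      let (w' , p' , w'∈T , u) = simplify p w∈T
          few = subst (_≤ n * 2) (LP.length-map startState w')
                      (unique-length stateIndex stateIndex-injective u)
      in shorter-intro (s≤s few) p' w'∈T

  -- So "T contains a b-path for e" is the same as "T implies e", and is decidable.
  implied⇒path : ∀ {T e} → Implied T e → HasBPath G T e
  implied⇒path = walk⇒path

  path⇒implied : ∀ {T e} → HasBPath G T e → Implied T e
  path⇒implied (w , (p , _) , w∈T) = w , p , w∈T

  hasBPath? : ∀ T e → Dec (HasBPath G T e)
  hasBPath? T e = map′ implied⇒path path⇒implied (walk? T _ _ _ _)

  hasBPath-mono : ∀ {T T'} → T ⊆ T' → ∀ {e} → HasBPath G T e → HasBPath G T' e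
  hasBPath-mono T⊆T' (w , bp , w∈T) = w , bp , All.map T⊆T' w∈T

  -- If T implies every edge of R, then T implies every edge of ft(G;R) = G.
  ft-transfer : ∀ {R T} → FtFull G R → (∀ g → g ∈ R → Implied T g) → ∀ e → Implied T e
  ft-transfer ftR R⇒T e with ftR e
  ... | inj₁ e∈R = R⇒T e e∈R
  ... | inj₂ (w , (p , _) , w∈R) = substitute p (All.map (λ {s} → R⇒T (proj₁ s)) w∈R)

  -- Irredundant: no edge of R has a b-path in the rest of R.
  Irredundant : Subset m → Set
  Irredundant R = ∀ e → e ∈ R → ¬ HasBPath G (R - e) e

  -- Removing an edge that the rest implies does not change ft.
  remove-implied : ∀ {R e} → FtFull G R → HasBPath G (R - e) e → FtFull G (R - e)
  remove-implied {R} {e} ftR e-implied f = inj₂ (implied⇒path (ft-transfer ftR kept f))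
    where
    kept : ∀ g → g ∈ R → Implied (R - e) g
    kept g g∈R with g FP.≟ e
    ... | yes refl = path⇒implied e-implied
    ... | no g≢e = single g (SP.x∈p∧x≢y⇒x∈p-y g∈R g≢e)

  -- Transitive reductions are exactly the irredundant R with ft(G;R) = G.
  reduction⇒irredundant : ∀ {R} → IsTransitiveReduction G R → Irredundant R
  reduction⇒irredundant {R} (ftR , minimal) e e∈R e-implied =
    x∉p-x R (subst (e ∈_) (sym (minimal (R - e) (SP.p─q⊆p R ⁅ e ⁆) (remove-implied ftR e-implied))) e∈R)

  irredundant⇒reduction : ∀ {R} → FtFull G R → Irredundant R → IsTransitiveReduction G R
  irredundant⇒reduction {R} ftR irredundant = ftR , λ R' R'⊆R ftR' → SP.⊆-antisym R'⊆R (R⊆ R'⊆R ftR')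
    where
    R⊆ : ∀ {R'} → R' ⊆ R → FtFull G R' → R ⊆ R'
    R⊆ {R'} R'⊆R ftR' {f} f∈R with f SP.∈? R' | ftR' f
    ... | yes f∈R' | _ = f∈R'
    ... | no f∉R' | inj₁ f∈R' = ⊥-elim (f∉R' f∈R')
    ... | no f∉R' | inj₂ f-implied =
      ⊥-elim (irredundant f f∈R (hasBPath-mono (⊆-minus R'⊆R f∉R') f-implied))

  -- The deletion process can always be run, since its test is decidable.
  run : ∀ H L → Σ (Subset m) (SeqDel G H L)
  run H [] = ⊥ , done
  run H (e ∷ L) with (e SP.∈? H) ×-dec hasBPath? (H - e) e
  ... | yes (e∈H , e-implied) = let (S , d) = run (H - e) L in ⁅ e ⁆ ∪ S , del e∈H e-implied d
  ... | no ¬deletable = let (S , d) = run H L in S , keep ¬deletable d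

  -- The surviving edges H ─ S still imply every edge of H.
  survivors-imply : ∀ {H L S} → SeqDel G H L S → ∀ e → e ∈ H → Implied (H ─ S) e
  survivors-imply {H} done e e∈H rewrite SP.p─⊥≡p H = single e e∈H
  survivors-imply {H} (del {e = f} {S = S} f∈H (w , (p , _) , w∈H-f) d) e e∈H
    rewrite delete-step H f S with e FP.≟ f
  ... | yes refl = substitute p (All.map (λ {s} → survivors-imply d (proj₁ s)) w∈H-f)
  ... | no e≢f = survivors-imply d e (SP.x∈p∧x≢y⇒x∈p-y e∈H e≢f)
  survivors-imply (keep _ d) e e∈H = survivors-imply d e e∈H

  -- A surviving edge that was examined is not implied by the other survivors:
  -- it was not implied by the larger graph present when it was examined.
  survivors-irredundant : ∀ {H L S} → SeqDel G H L S → ∀ f → f ∈ₗ L → f ∈ H ─ S →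
                          ¬ HasBPath G ((H ─ S) - f) f
  survivors-irredundant (del {H = H} {S = S} _ _ _) f (here refl) f∈ =
    ⊥-elim (∈─⇒∉ H (⁅ f ⁆ ∪ S) f∈ (SP.x∈p∪q⁺ (inj₁ (SP.x∈⁅x⁆ f))))
  survivors-irredundant (del {H = H} {e = e} {S = S} _ _ d) f (there i) f∈
    rewrite delete-step H e S = survivors-irredundant d f i f∈
  survivors-irredundant (keep {H = H} {S = S} ¬deletable _) f (here refl) f∈ f-implied =
    ¬deletable (SP.p─q⊆p H S f∈ , hasBPath-mono (─-monoˡ ⁅ f ⁆ (SP.p─q⊆p H S)) f-implied)
  survivors-irredundant (keep _ d) f (there i) f∈ = survivors-irredundant d f i f∈

  -- Forward direction: along any ordering the deletion process can be run,
  -- and what it leaves is a transitive reduction.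
  greedy-reduction : ∀ π S → IsS G π S → IsTransitiveReduction G (delete G S)
  greedy-reduction π S d = irredundant⇒reduction ft irredundant
    where
    ft : FtFull G (delete G S)
    ft e = inj₂ (implied⇒path (survivors-imply d e SP.∈⊤))
    irredundant : Irredundant (delete G S)
    irredundant f = survivors-irredundant d f (∈-permutationList π f)

  -- Converse direction, for a fixed transitive reduction R.
  module _ {R : Subset m} (reduction : IsTransitiveReduction G R) where

    -- Edges of R are never deleted when only edges of R remain.
    nothing-deleted : ∀ {H L S} → H ⊆ R → All (_∈ R) L → SeqDel G H L S → S ≡ ⊥
    nothing-deleted _ _ done = refl
    nothing-deleted H⊆R (a∈R ∷ _) (del _ a-implied _) =
      ⊥-elim (reduction⇒irredundant reduction _ a∈R (hasBPath-mono (─-monoˡ _ H⊆R) a-implied))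
    nothing-deleted H⊆R (_ ∷ L⊆R) (keep _ d) = nothing-deleted H⊆R L⊆R d

    -- Covering: the list A contains all edges of H outside R.
    Covers : List (Fin m) → Subset m → Set
    Covers A H = ∀ e → e ∈ H → e ∉ R → e ∈ₗ A

    -- Dropping the head a of the list keeps covering once a is absent.
    covers-tail : ∀ {a A H H'} → Covers (a ∷ A) H → H' ⊆ H → a ∉ H' → Covers A H'
    covers-tail covers H'⊆H a∉H' e e∈H' e∉R with covers e (H'⊆H e∈H') e∉R
    ... | here refl = ⊥-elim (a∉H' e∈H')
    ... | there e∈A = e∈A

    -- Processing first all edges outside R (covering those present) and then
    -- edges of R deletes exactly the edges outside R.
    redundant-deleted : ∀ {H A B S} → R ⊆ H → All (_∉ R) A → All (_∈ R) B → Covers A H →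
                        SeqDel G H (A ++ B) S → H ─ S ≡ R
    redundant-deleted {H} {[]} {S = S} R⊆H _ B⊆R covers d = begin
        H ─ S  ≡⟨ cong (H ─_) (nothing-deleted H⊆R B⊆R d) ⟩
        H ─ ⊥  ≡⟨ SP.p─⊥≡p H ⟩
        H      ≡⟨ SP.⊆-antisym H⊆R R⊆H ⟩
        R      ∎
      where
      open ≡-Reasoning
      H⊆R : H ⊆ R
      H⊆R {e} e∈H = decidable-stable (e SP.∈? R) (λ e∉R → ¬Any[] (covers e e∈H e∉R))
    redundant-deleted {H} {a ∷ A} R⊆H (a∉R ∷ A∉R) B⊆R covers (del {S = S} _ _ d) =
      trans (delete-step H a S)
            (redundant-deleted (⊆-minus R⊆H a∉R) A∉R B⊆R
              (covers-tail covers (SP.p─q⊆p H ⁅ a ⁆) (x∉p-x H)) d)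
    redundant-deleted {H} {a ∷ A} R⊆H (a∉R ∷ A∉R) B⊆R covers (keep ¬deletable d) =
      redundant-deleted R⊆H A∉R B⊆R (covers-tail covers SP.⊆-refl a∉H) d
      where
      -- a would be deleted: R implies it and R ⊆ H - a.
      a∉H : a ∉ H
      a∉H a∈H with proj₁ reduction a
      ... | inj₁ a∈R = a∉R a∈R
      ... | inj₂ a-implied = ¬deletable (a∈H , hasBPath-mono (⊆-minus R⊆H a∉R) a-implied)

    -- Ordering the edges outside R first, the deletion process yields R.
    reduction-is-greedy : Σ (Permutation′ m) λ π → Σ (Subset m) λ S → IsS G π S × R ≡ delete G S
    reduction-is-greedy with partition-order m (_∉ R) (λ e → ¬? (e SP.∈? R))
    ... | π , A , B , order≡ , A∉R , B¬∉R with run ⊤ (orderList G π)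
    ...   | S , d = π , S , d , sym (redundant-deleted SP.⊆⊤ A∉R B⊆R covers d')
      where
      d' : SeqDel G ⊤ (A ++ B) S
      d' = subst (λ L → SeqDel G ⊤ L S) order≡ d
      B⊆R : All (_∈ R) B
      B⊆R = All.map (decidable-stable (_ SP.∈? R)) B¬∉R
      covers : Covers A ⊤
      covers e _ e∉R with MP.∈-++⁻ A (subst (e ∈ₗ_) order≡ (∈-permutationList π e))
      ... | inj₁ e∈A = e∈A
      ... | inj₂ e∈B = ⊥-elim (e∉R (All.lookup B⊆R e∈B))

proposition42 : (G : BiGraph) →
    ((π : Permutation′ (BiGraph.m G)) →
    Σ (Subset (BiGraph.m G)) (λ S → IsS G π S) ×
    (∀ S → IsS G π S → IsTransitiveReduction G (delete G S))) ×
    ((R : Subset (BiGraph.m G)) → IsTransitiveReduction G R →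
    Σ (Permutation′ (BiGraph.m G)) (λ π →
    Σ (Subset (BiGraph.m G)) (λ S → IsS G π S × R ≡ delete G S)))
proposition42 G =
  (λ π → run G ⊤ (orderList G π) , greedy-reduction G π) ,
  (λ R reduction → reduction-is-greedy G reduction)
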